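{- The set $\mathbf{M}$ is $\Sigma^0_1$-complete, indeed $1$-complete; $\mathbf{M}$ is creative; and $\mathbf{M}$ is computably isomorphic to $K$.
   Context: $(\varphi_e)_{e\in\mathbb{N}}$ is a fixed standard acceptable numbering of the unary partial computable functions (with the s-m-n and universal-machine properties); $\mathbf{M}=\{p\in\mathbb{N}:\varphi_p(0)\!\downarrow=1\}$ and $K=\{e:\varphi_e(e)\!\downarrow\}$. $1$-complete means c.e. and every c.e. set is $1$-reducible to it. Computably isomorphic means there is a computable permutation of $\mathbb{N}$ carrying one set onto the other. -}

module Defs where

open import Data.Bool.Base using (Bool; T; if_then_else_)
open import Data.Fin.Base using (Fin)
open import Data.Nat.Base using (ℕ; zero; suc; _+_; _<_)
open import Data.Product.Base using (Σ; ∃; ∃-syntax; _×_)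
open import Data.Unit.Base using (⊤)
open import Data.Vec.Base using (Vec; []; _∷_; lookup)
open import Function.Bundles using (_⇔_; _⤖_; Bijection)
open import Function.Definitions using (Injective)
open import Level using (0ℓ)
open import Relation.Binary.PropositionalEquality.Core using (_≡_)
open import Relation.Unary using (Pred; _∈_; _∉_; _⊆_; ∁)

-- Codes for the partial recursive functions of each arity.  Recursion and
-- minimisation act on the first argument; in `prec f g` the step function `g`
-- receives the counter, the previous value and the parameters, in that order.
data Code : ℕ → Set where
  zeroᶜ : Code 0
  sucᶜ  : Code 1
  proj  : ∀ {n} → Fin n → Code n
  comp  : ∀ {m n} → Code m → Vec (Code n) m → Code n
  prec  : ∀ {n} → Code n → Code (2 + n) → Code (1 + n)
  μ     : ∀ {n} → Code (1 + n) → Code n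

-- Partial functions are represented by their graphs: `⟦ c ⟧ xs y` says that
-- the computation of `c` on `xs` converges with value `y`.
PrecGraph : ∀ {n} → (Vec ℕ n → ℕ → Set) → (Vec ℕ (2 + n) → ℕ → Set) →
            ℕ → Vec ℕ n → ℕ → Set
PrecGraph F G zero    xs y = F xs y
PrecGraph F G (suc k) xs y = ∃[ z ] PrecGraph F G k xs z × G (k ∷ z ∷ xs) y

mutual
  ⟦_⟧ : ∀ {n} → Code n → Vec ℕ n → ℕ → Set
  ⟦ zeroᶜ ⟧     xs       y = 0 ≡ y
  ⟦ sucᶜ ⟧      (x ∷ []) y = suc x ≡ y
  ⟦ proj i ⟧    xs       y = lookup xs i ≡ y
  ⟦ comp f gs ⟧ xs       y = ∃[ ys ] ⟦ gs ⟧* xs ys × ⟦ f ⟧ ys y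
  ⟦ prec f g ⟧  (k ∷ xs) y = PrecGraph ⟦ f ⟧ ⟦ g ⟧ k xs y
  -- `f` must converge at every argument below the least zero
  ⟦ μ f ⟧       xs       y = ⟦ f ⟧ (y ∷ xs) 0 ×
                             (∀ i → i < y → ∃[ z ] ⟦ f ⟧ (i ∷ xs) (suc z))

  ⟦_⟧* : ∀ {m n} → Vec (Code n) m → Vec ℕ n → Vec ℕ m → Set
  ⟦ [] ⟧*     xs []       = ⊤
  ⟦ g ∷ gs ⟧* xs (y ∷ ys) = ⟦ g ⟧ xs y × ⟦ gs ⟧* xs ys

PartialComputable₁ : (ℕ → ℕ → Set) → Set
PartialComputable₁ ψ = Σ (Code 1) λ c → ∀ x y → ψ x y ⇔ ⟦ c ⟧ (x ∷ []) y

PartialComputable₂ : (ℕ → ℕ → ℕ → Set) → Set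
PartialComputable₂ ψ =
  Σ (Code 2) λ c → ∀ w x y → ψ w x y ⇔ ⟦ c ⟧ (w ∷ x ∷ []) y

Computable₁ : (ℕ → ℕ) → Set
Computable₁ f = PartialComputable₁ λ x y → f x ≡ y

Computable₂ : (ℕ → ℕ → ℕ) → Set
Computable₂ f = PartialComputable₂ λ w x y → f w x ≡ y

ComputableRelation : (ℕ → ℕ → Bool) → Set
ComputableRelation χ = Computable₂ λ w x → if χ w x then 1 else 0

-- `φ e x y` says that φₑ(x) converges with value y.  Single-valuedness, and
-- the partial computability of each φₑ, are consequences of `universal`.
record IsAcceptable (φ : ℕ → ℕ → ℕ → Set) : Set₁ where
  field
    surjective : ∀ ψ → PartialComputable₁ ψ →
                 ∃[ e ] ∀ x y → φ e x y ⇔ ψ x y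
    universal  : PartialComputable₂ φ
    s-m-n      : ∀ ψ → PartialComputable₂ ψ →
                 Σ (ℕ → ℕ) λ s → Computable₁ s ×
                   (∀ w x y → φ (s w) x y ⇔ ψ w x y)

W : (ℕ → ℕ → ℕ → Set) → ℕ → Pred ℕ 0ℓ
W φ e x = ∃[ y ] φ e x y

M : (ℕ → ℕ → ℕ → Set) → Pred ℕ 0ℓ
M φ p = φ p 0 1

K : (ℕ → ℕ → ℕ → Set) → Pred ℕ 0ℓ
K φ e = ∃[ y ] φ e e y

IsCE : Pred ℕ 0ℓ → Set
IsCE A = Σ (Code 1) λ c → ∀ x → x ∈ A ⇔ (∃[ y ] ⟦ c ⟧ (x ∷ []) y)

IsΣ⁰₁ : Pred ℕ 0ℓ → Set
IsΣ⁰₁ A = Σ (ℕ → ℕ → Bool) λ R → ComputableRelation R ×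
            (∀ x → x ∈ A ⇔ (∃[ y ] T (R x y)))

_≤ₘ_ : Pred ℕ 0ℓ → Pred ℕ 0ℓ → Set
A ≤ₘ B = Σ (ℕ → ℕ) λ f → Computable₁ f × (∀ x → x ∈ A ⇔ f x ∈ B)

_≤₁_ : Pred ℕ 0ℓ → Pred ℕ 0ℓ → Set
A ≤₁ B = Σ (ℕ → ℕ) λ f → Computable₁ f × Injective _≡_ _≡_ f ×
           (∀ x → x ∈ A ⇔ f x ∈ B)

Σ⁰₁-Complete : Pred ℕ 0ℓ → Set₁
Σ⁰₁-Complete B = IsΣ⁰₁ B × (∀ A → IsΣ⁰₁ A → A ≤ₘ B)

1-Complete : Pred ℕ 0ℓ → Set₁
1-Complete B = IsCE B × (∀ A → IsCE A → A ≤₁ B)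

-- The productive function is required to be total; this implies the variant
-- in which it need only converge on those e with Wₑ ⊆ P.
Productive : (ℕ → ℕ → ℕ → Set) → Pred ℕ 0ℓ → Set
Productive φ P = Σ (ℕ → ℕ) λ p → Computable₁ p ×
                   (∀ e → W φ e ⊆ P → p e ∈ P × p e ∉ W φ e)

Creative : (ℕ → ℕ → ℕ → Set) → Pred ℕ 0ℓ → Set
Creative φ C = IsCE C × Productive φ (∁ C)

ComputablyIsomorphic : Pred ℕ 0ℓ → Pred ℕ 0ℓ → Set
ComputablyIsomorphic A B =
  Σ (ℕ ⤖ ℕ) λ h → Computable₁ (Bijection.to h) ×
    (∀ y → y ∈ B ⇔ (∃[ x ] x ∈ A × Bijection.to h x ≡ y))

{-# OPTIONS --safe #-}

-- Membership in M constrains φ p only at 0, so in a reduction of a c.e. set to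
-- M the value at 1 can record the argument, which makes the reduction
-- injective without a padding lemma; for K the recursion theorem leaves every
-- argument but the diagonal one free for the same purpose.  Hence M and K are
-- both 1-complete.  Between 1-complete sets A and B there are injective
-- reductions f with x < f x: a 1-reduction of the join of A and B to B gives
-- s reducing A to B and q reducing B to itself with disjoint ranges, and some
-- term of the injective sequence s x, q (s x), q (q (s x)), … exceeds x.  For
-- such reductions the ranges are decidable and backward chains decrease, so
-- the Schröder–Bernstein bijection is computable.
module Submission where

open import Data.Bool.Base using (true; T; if_then_else_)
open import Data.Fin.Base using (Fin; zero; suc; toℕ; fromℕ<; _↑ʳ_)
open import Data.Fin.Properties using (injective⇒≤; toℕ<n; toℕ-fromℕ<; toℕ-injective)
open import Data.Nat.Base
  using (ℕ; zero; suc; pred; _+_; _∸_; _<_; _≤_; _⊔_; _≡ᵇ_; ∣_-_∣; s≤s)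
open import Data.Nat.Properties
open import Data.Product.Base using (Σ; ∃-syntax; _×_; _,_; proj₁; proj₂)
open import Data.Sum.Base using (_⊎_; inj₁; inj₂)
open import Data.Unit.Base using (tt)
open import Data.Vec.Base using (Vec; []; _∷_; lookup; drop; tabulate)
open import Function.Base using (_∘_; id)
open import Function.Bundles using (_⇔_; mk⇔; mk⤖; Equivalence)
open import Function.Definitions using (Injective)
open import Level using (0ℓ)
open import Relation.Binary.PropositionalEquality
open import Relation.Nullary using (¬_; contradiction)
open import Relation.Unary using (Pred; _∈_; _∉_)
open import Defs

open Equivalence using (to; from)

private variable
  m n : ℕ
  A B : Pred ℕ 0ℓ

-- Total computable functions

-- Function, program and correctness are built together, so each combinator yields a function that
-- Agda can evaluate along with a code for it.
record Total (n : ℕ) : Set where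
  field
    fun      : Vec ℕ n → ℕ
    code     : Code n
    computes : ∀ xs → ⟦ code ⟧ xs (fun xs)

record TotalMap (n m : ℕ) : Set where
  field
    funs      : Vec ℕ n → Vec ℕ m
    codes     : Vec (Code n) m
    computes* : ∀ xs → ⟦ codes ⟧* xs (funs xs)

open Total
open TotalMap

infix  20 _⟨_⟩
infixr 5 _∷ᵗ_

_⟨_⟩ : Total m → TotalMap n m → Total n
fun      (t ⟨ σ ⟩) xs = fun t (funs σ xs)
code     (t ⟨ σ ⟩)    = comp (code t) (codes σ)
computes (t ⟨ σ ⟩) xs = funs σ xs , computes* σ xs , computes t (funs σ xs)

[]ᵗ : TotalMap n 0
funs      []ᵗ xs = []
codes     []ᵗ    = []
computes* []ᵗ xs = tt

_∷ᵗ_ : Total n → TotalMap n m → TotalMap n (suc m)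
funs      (t ∷ᵗ σ) xs = fun t xs ∷ funs σ xs
codes     (t ∷ᵗ σ)    = code t ∷ codes σ
computes* (t ∷ᵗ σ) xs = computes t xs , computes* σ xs

computes-tabulate : ∀ (ρ : Fin m → Fin n) (xs : Vec ℕ n) (ys : Vec ℕ m) →
  (∀ i → lookup xs (ρ i) ≡ lookup ys i) → ⟦ tabulate (proj ∘ ρ) ⟧* xs ys
computes-tabulate ρ xs []       eq = tt
computes-tabulate ρ xs (y ∷ ys) eq =
  eq zero , computes-tabulate (ρ ∘ suc) xs ys (eq ∘ suc)

lookup-drop : ∀ k (xs : Vec ℕ (k + n)) i → lookup xs (k ↑ʳ i) ≡ lookup (drop k xs) i
lookup-drop zero    xs       i = refl
lookup-drop (suc k) (x ∷ xs) i = lookup-drop k xs i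

dropᵗ : ∀ k → TotalMap (k + n) n
funs      (dropᵗ k) xs = drop k xs
codes     (dropᵗ k)    = tabulate (proj ∘ (k ↑ʳ_))
computes* (dropᵗ k) xs =
  computes-tabulate (k ↑ʳ_) xs (drop k xs) (lookup-drop k xs)

var : Fin n → Total n
fun      (var i) xs = lookup xs i
code     (var i)    = proj i
computes (var i) xs = refl

v₀ : Total (1 + n)
v₀ = var zero

v₁ : Total (2 + n)
v₁ = var (suc zero)

v₂ : Total (3 + n)
v₂ = var (suc (suc zero))

sucᵗ : Total 1
fun      sucᵗ (x ∷ []) = suc x
code     sucᵗ          = sucᶜ
computes sucᵗ (x ∷ []) = refl

constᵗ : ℕ → Total n
fun      (constᵗ k) xs = k
code     (constᵗ zero)    = comp zeroᶜ []
code     (constᵗ (suc k)) = comp sucᶜ (code (constᵗ k) ∷ [])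
computes (constᵗ zero)    xs = [] , tt , refl
computes (constᵗ (suc k)) xs = k ∷ [] , (computes (constᵗ k) xs , tt) , refl

natrec : ℕ → (ℕ → ℕ → ℕ) → ℕ → ℕ
natrec z s zero    = z
natrec z s (suc k) = s k (natrec z s k)

recᵗ : Total n → Total (2 + n) → Total (1 + n)
fun  (recᵗ z s) (k ∷ xs) = natrec (fun z xs) (λ j r → fun s (j ∷ r ∷ xs)) k
code (recᵗ z s) = prec (code z) (code s)
computes (recᵗ z s) (k ∷ xs) = go k
  where
  go : ∀ k → PrecGraph ⟦ code z ⟧ ⟦ code s ⟧ k xs (fun (recᵗ z s) (k ∷ xs))
  go zero    = computes z xs
  go (suc k) = _ , go k , computes s _

-- Keeps the program but exchanges its value function for a familiar one, so that later goals show
-- ordinary arithmetic instead of `natrec`.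
substᵗ : (t : Total n) (f : Vec ℕ n → ℕ) → (∀ xs → fun t xs ≡ f xs) → Total n
fun      (substᵗ t f eq)    = f
code     (substᵗ t f eq)    = code t
computes (substᵗ t f eq) xs = subst (⟦ code t ⟧ xs) (eq xs) (computes t xs)

ifz : ℕ → ℕ → ℕ → ℕ
ifz zero    a b = a
ifz (suc _) a b = b

ifzᵗ : Total 3
ifzᵗ = substᵗ (recᵗ v₀ (var (suc (suc (suc zero)))))
  (λ { (k ∷ a ∷ b ∷ []) → ifz k a b })
  (λ { (zero ∷ a ∷ b ∷ []) → refl ; (suc k ∷ a ∷ b ∷ []) → refl })

-- Both branches are computed, which is harmless for total functions only; a choice between partial
-- computations is made on indices instead.
if₀ : Total n → Total n → Total n → Total n
if₀ k a b = ifzᵗ ⟨ k ∷ᵗ a ∷ᵗ b ∷ᵗ []ᵗ ⟩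

predᵗ : Total 1
predᵗ = substᵗ (recᵗ (constᵗ 0) v₀) (λ { (x ∷ []) → pred x })
  (λ { (zero ∷ []) → refl ; (suc x ∷ []) → refl })

∸ᵗ : Total 2
∸ᵗ = substᵗ (flipped ⟨ v₁ ∷ᵗ v₀ ∷ᵗ []ᵗ ⟩) (λ { (x ∷ y ∷ []) → x ∸ y })
  (λ { (x ∷ y ∷ []) → correct x y })
  where
  flipped : Total 2
  flipped = recᵗ v₀ (predᵗ ⟨ v₁ ∷ᵗ []ᵗ ⟩)
  correct : ∀ x y → fun flipped (y ∷ x ∷ []) ≡ x ∸ y
  correct x zero    = refl
  correct x (suc y) = trans (cong pred (correct x y)) (pred[m∸n]≡m∸[1+n] x y)

-- Its zeros are the equal pairs, which makes it the equality test for `if₀`.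
distᵗ : Total 2
distᵗ = substᵗ (if₀ ∸ᵗ (∸ᵗ ⟨ v₁ ∷ᵗ v₀ ∷ᵗ []ᵗ ⟩) ∸ᵗ)
  (λ { (x ∷ y ∷ []) → ∣ x - y ∣ }) (λ { (x ∷ y ∷ []) → correct x y })
  where
  correct : ∀ x y → ifz (x ∸ y) (y ∸ x) (x ∸ y) ≡ ∣ x - y ∣
  correct zero    zero    = refl
  correct zero    (suc y) = refl
  correct (suc x) zero    = refl
  correct (suc x) (suc y) = correct x y

ifz-≡ : ∀ {x y} → x ≡ y → ∀ a b → ifz ∣ x - y ∣ a b ≡ a
ifz-≡ x≡y a b = cong (λ k → ifz k a b) (m≡n⇒∣m-n∣≡0 x≡y)

ifz-≢ : ∀ {x y} → x ≢ y → ∀ a b → ifz ∣ x - y ∣ a b ≡ b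
ifz-≢ {x} {y} x≢y a b with ∣ x - y ∣ in eq
... | zero  = contradiction (∣m-n∣≡0⇒m≡n eq) x≢y
... | suc _ = refl

-- Inverts the guards of the evaluator: the failure branch 0 cannot produce a successor.
ifz-suc : ∀ r {k y} → ifz r 0 k ≡ suc y → (∃[ z ] r ≡ suc z) × k ≡ suc y
ifz-suc (suc z) eq = (z , refl) , eq

-- Step-bounded evaluation

-- `search h j` inspects h 0, …, h (j - 1), where h i = 0 means that the i-th
-- value is unknown and h i = 1 + v that it is v.  The result is 0 as long as
-- all values are positive, 2 + y once y is found to be the first zero, and
-- 1 after an unknown value.
search : (ℕ → ℕ) → ℕ → ℕ
search h = natrec 0 λ j s → ifz s (ifz (h j) 1 (ifz (pred (h j)) (2 + j) 0)) s

PositiveBelow : (ℕ → ℕ) → ℕ → Set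
PositiveBelow h j = ∀ i → i < j → ∃[ z ] h i ≡ 2 + z

extend : ∀ {h j z} → PositiveBelow h j → h j ≡ 2 + z → PositiveBelow h (suc j)
extend p eq i i<1+j with m<1+n⇒m<n∨m≡n i<1+j
... | inj₁ i<j  = p i i<j
... | inj₂ refl = _ , eq

search≡0⇒positive : ∀ h j → search h j ≡ 0 → PositiveBelow h j
search≡0⇒positive h zero    eq i ()
search≡0⇒positive h (suc j) eq with search h j in s | h j in v
... | zero | suc (suc z) = extend (search≡0⇒positive h j s) v

search≡2+y⇒least : ∀ h j {y} → search h j ≡ 2 + y → h y ≡ 1 × PositiveBelow h y
search≡2+y⇒least h (suc j) eq with search h j in s | h j in v
search≡2+y⇒least h (suc j) refl | zero | suc zero =
  v , search≡0⇒positive h j s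
search≡2+y⇒least h (suc j) refl | suc (suc y) | _ = search≡2+y⇒least h j s

positive⇒search≡0 : ∀ h j → PositiveBelow h j → search h j ≡ 0
positive⇒search≡0 h zero    p = refl
positive⇒search≡0 h (suc j) p
  rewrite positive⇒search≡0 h j (λ i i<j → p i (m<n⇒m<1+n i<j))
        | proj₂ (p j ≤-refl) = refl

least⇒search≡2+y : ∀ h {y} → h y ≡ 1 → PositiveBelow h y →
  ∀ j → y < j → search h j ≡ 2 + y
least⇒search≡2+y h hy p (suc j) y<1+j with m<1+n⇒m<n∨m≡n y<1+j
... | inj₁ y<j  rewrite least⇒search≡2+y h hy p j y<j = refl
... | inj₂ refl rewrite positive⇒search≡0 h j p | hy  = refl

-- The first argument is the fuel; the result is 0 when it does not suffice
-- and 1 + y when the computation converges to y.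
mutual
  evalᵗ : Code n → Total (1 + n)
  evalᵗ zeroᶜ       = constᵗ 1
  evalᵗ sucᶜ        = sucᵗ ⟨ sucᵗ ⟨ v₁ ∷ᵗ []ᵗ ⟩ ∷ᵗ []ᵗ ⟩
  evalᵗ (proj i)    = sucᵗ ⟨ var (suc i) ∷ᵗ []ᵗ ⟩
  evalᵗ (comp f gs) = guardᵗ gs (evalᵗ f ⟨ v₀ ∷ᵗ valuesᵗ gs ⟩)
  evalᵗ (prec f g)  =
    -- The input `t ∷ k ∷ xs` is reordered so that recursion runs on `k`; all stages share the fuel
    -- `t`.
    recᵗ (evalᵗ f)
         (if₀ v₁ (constᵗ 0)
           (evalᵗ g ⟨ v₂ ∷ᵗ v₀ ∷ᵗ predᵗ ⟨ v₁ ∷ᵗ []ᵗ ⟩ ∷ᵗ dropᵗ 3 ⟩))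
      ⟨ v₁ ∷ᵗ v₀ ∷ᵗ dropᵗ 2 ⟩
  evalᵗ (μ f)       =
    -- The fuel bounds both the search range and each evaluation. The outer `predᵗ` turns the final
    -- state 2 + y into 1 + y and the states 0 and 1 into failure.
    predᵗ ⟨ recᵗ (constᵗ 0)
              (if₀ v₁
                (if₀ value (constᵗ 1)
                  (if₀ (predᵗ ⟨ value ∷ᵗ []ᵗ ⟩)
                    (sucᵗ ⟨ sucᵗ ⟨ v₀ ∷ᵗ []ᵗ ⟩ ∷ᵗ []ᵗ ⟩) (constᵗ 0)))
                v₁)
            ⟨ v₀ ∷ᵗ v₀ ∷ᵗ dropᵗ 1 ⟩ ∷ᵗ []ᵗ ⟩
    where value = evalᵗ f ⟨ v₂ ∷ᵗ v₀ ∷ᵗ dropᵗ 3 ⟩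

  -- An unfinished component appears as the default 0; `guardᵗ` keeps it from being taken for a
  -- value.
  valuesᵗ : Vec (Code n) m → TotalMap (1 + n) m
  valuesᵗ []       = []ᵗ
  valuesᵗ (g ∷ gs) = predᵗ ⟨ evalᵗ g ∷ᵗ []ᵗ ⟩ ∷ᵗ valuesᵗ gs

  guardᵗ : Vec (Code n) m → Total (1 + n) → Total (1 + n)
  guardᵗ []       t = t
  guardᵗ (g ∷ gs) t = if₀ (evalᵗ g) (constᵗ 0) (guardᵗ gs t)

eval : Code n → ℕ → Vec ℕ n → ℕ
eval c t xs = fun (evalᵗ c) (t ∷ xs)

mutual
  eval-sound : ∀ (c : Code n) t xs {y} → eval c t xs ≡ suc y → ⟦ c ⟧ xs y
  eval-sound zeroᶜ       t xs       eq = suc-injective eq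
  eval-sound sucᶜ        t (x ∷ []) eq = suc-injective eq
  eval-sound (proj i)    t xs       eq = suc-injective eq
  eval-sound (comp f gs) t xs       eq with guard-sound gs _ t xs eq
  ... | ⟦gs⟧ , eq′ = _ , ⟦gs⟧ , eval-sound f t _ eq′
  eval-sound (prec f g)  t (k ∷ xs) eq = go k eq
    where
    go : ∀ k {y} → eval (prec f g) t (k ∷ xs) ≡ suc y →
         PrecGraph ⟦ f ⟧ ⟦ g ⟧ k xs y
    go zero    eq = eval-sound f t xs eq
    go (suc k) eq with ifz-suc (eval (prec f g) t (k ∷ xs)) eq
    ... | (z , eq₁) , eq₂ = z , go k eq₁ ,
      eval-sound g t (k ∷ z ∷ xs)
        (trans (cong (λ r → eval g t (k ∷ pred r ∷ xs)) (sym eq₁)) eq₂)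
  eval-sound (μ f) t xs {y} eq
    with search (λ j → eval f t (j ∷ xs)) t in found
  eval-sound (μ f) t xs refl | suc (suc y)
    with search≡2+y⇒least (λ j → eval f t (j ∷ xs)) t found
  ... | zero-at-y , positive =
    eval-sound f t (y ∷ xs) zero-at-y ,
    λ i i<y → proj₁ (positive i i<y) ,
              eval-sound f t (i ∷ xs) (proj₂ (positive i i<y))

  guard-sound : ∀ (gs : Vec (Code n) m) b t xs {y} →
    fun (guardᵗ gs b) (t ∷ xs) ≡ suc y →
    ⟦ gs ⟧* xs (funs (valuesᵗ gs) (t ∷ xs)) × fun b (t ∷ xs) ≡ suc y
  guard-sound []       b t xs eq = tt , eq
  guard-sound (g ∷ gs) b t xs eq with ifz-suc (eval g t xs) eq
  ... | (z , eq₁) , eq₂ with guard-sound gs b t xs eq₂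
  ... | ⟦gs⟧ , eq₃ =
    (subst (⟦ g ⟧ xs) (sym (cong pred eq₁)) (eval-sound g t xs eq₁) , ⟦gs⟧) , eq₃

-- Asking for all large fuel, not just for some, lets the bounds of subcomputations be merged by
-- maxima without proving `eval` monotone.
Eventually : (ℕ → Set) → Set
Eventually P = ∃[ t₀ ] ∀ t → t₀ ≤ t → P t

eventually₂ : ∀ {P Q R : ℕ → Set} → (∀ {t} → P t → Q t → R t) →
  Eventually P → Eventually Q → Eventually R
eventually₂ f (s , p) (t , q) = s ⊔ t , λ u s⊔t≤u →
  f (p u (m⊔n≤o⇒m≤o s t s⊔t≤u)) (q u (m⊔n≤o⇒n≤o s t s⊔t≤u))

-- Minimisation evaluates all arguments below the zero with the same fuel, so they need a common
-- bound.
eventually-below : ∀ {P : ℕ → ℕ → Set} k → (∀ i → i < k → Eventually (P i)) →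
  Eventually (λ t → ∀ i → i < k → P i t)
eventually-below zero    e = 0 , λ t _ i ()
eventually-below {P} (suc k) e =
  eventually₂ (λ p q i i<1+k → combine p q (m<1+n⇒m<n∨m≡n i<1+k))
    (eventually-below k λ i i<k → e i (m<n⇒m<1+n i<k)) (e k ≤-refl)
  where
  combine : ∀ {t i} → (∀ i → i < k → P i t) → P k t → i < k ⊎ i ≡ k → P i t
  combine p q (inj₁ i<k)  = p _ i<k
  combine p q (inj₂ refl) = q

mutual
  eval-complete : ∀ (c : Code n) xs {y} → ⟦ c ⟧ xs y →
    Eventually λ t → eval c t xs ≡ suc y
  eval-complete zeroᶜ       xs       eq = 0 , λ _ _ → cong suc eq
  eval-complete sucᶜ        (x ∷ []) eq = 0 , λ _ _ → cong suc eq
  eval-complete (proj i)    xs       eq = 0 , λ _ _ → cong suc eq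
  eval-complete (comp f gs) xs (ys , ⟦gs⟧ , ⟦f⟧) =
    eventually₂ (λ { {t} (refl , passes) eq → trans (passes _) eq })
      (guard-complete gs xs ⟦gs⟧) (eval-complete f ys ⟦f⟧)
  eval-complete (prec f g) (k ∷ xs) graph = go k graph
    where
    go : ∀ k {y} → PrecGraph ⟦ f ⟧ ⟦ g ⟧ k xs y →
         Eventually λ t → eval (prec f g) t (k ∷ xs) ≡ suc y
    go zero    ⟦f⟧             = eval-complete f xs ⟦f⟧
    go (suc k) (z , rest , ⟦g⟧) =
      eventually₂ (λ {t} eq₁ eq₂ → trans
          (cong (λ r → ifz r 0 (eval g t (k ∷ pred r ∷ xs))) eq₁) eq₂)
        (go k rest) (eval-complete g (k ∷ z ∷ xs) ⟦g⟧)
  eval-complete (μ f) xs {y} (⟦f⟧ , positive) =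
    eventually₂ (λ { {t} zero-at-y (y<t , below) → cong pred
        (least⇒search≡2+y (λ j → eval f t (j ∷ xs)) zero-at-y below t y<t) })
      (eval-complete f (y ∷ xs) ⟦f⟧)
      -- The fuel must also exceed y, since the search inspects only arguments below it.
      (eventually₂ _,_ (suc y , λ _ y<t → y<t)
        (eventually-below y λ i i<y →
          let z , ⟦f⟧ᵢ = positive i i<y
              t , eq   = eval-complete f (i ∷ xs) ⟦f⟧ᵢ
          in t , λ t′ t≤t′ → z , eq t′ t≤t′))

  guard-complete : ∀ (gs : Vec (Code n) m) xs {ys} → ⟦ gs ⟧* xs ys →
    Eventually λ t → funs (valuesᵗ gs) (t ∷ xs) ≡ ys ×
                     (∀ b → fun (guardᵗ gs b) (t ∷ xs) ≡ fun b (t ∷ xs))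
  guard-complete []       xs {[]}     tt = 0 , λ _ _ → refl , λ _ → refl
  guard-complete (g ∷ gs) xs {y ∷ ys} (⟦g⟧ , ⟦gs⟧) =
    eventually₂ (λ { {t} eq (eqs , passes) → cong₂ _∷_ (cong pred eq) eqs ,
        λ b → trans (cong (λ r → ifz r 0 _) eq) (passes b) })
      (eval-complete g xs ⟦g⟧) (guard-complete gs xs ⟦gs⟧)

-- Both computations are visible to `eval` at one common fuel, and `eval` is a function.
deterministic : ∀ (c : Code n) xs {y y′} → ⟦ c ⟧ xs y → ⟦ c ⟧ xs y′ → y ≡ y′
deterministic c xs p q
  with eval-complete c xs p | eval-complete c xs q
... | s , eq | t , eq′ = suc-injective
  (trans (sym (eq (s ⊔ t) (m≤m⊔n s t))) (eq′ (s ⊔ t) (m≤n⊔m s t)))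

deterministic* : ∀ (gs : Vec (Code n) m) xs {ys ys′} →
  ⟦ gs ⟧* xs ys → ⟦ gs ⟧* xs ys′ → ys ≡ ys′
deterministic* []       xs {[]}    {[]}    _       _         = refl
deterministic* (g ∷ gs) xs {_ ∷ _} {_ ∷ _} (p , ps) (q , qs) =
  cong₂ _∷_ (deterministic g xs p q) (deterministic* gs xs ps qs)

-- The intermediate values are unique, so the existential in a composition collapses to the known
-- tuple.
⟦comp⟧⇔ : ∀ (c : Code m) (gs : Vec (Code n) m) {xs ys y} → ⟦ gs ⟧* xs ys →
  ⟦ comp c gs ⟧ xs y ⇔ ⟦ c ⟧ ys y
⟦comp⟧⇔ c gs {xs} {y = y} ⟦gs⟧ = mk⇔
  (λ { (_ , ⟦gs⟧′ , ⟦c⟧) →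
     subst (λ ys → ⟦ c ⟧ ys y) (deterministic* gs xs ⟦gs⟧′ ⟦gs⟧) ⟦c⟧ })
  (λ ⟦c⟧ → _ , ⟦gs⟧ , ⟦c⟧)

total₁ : ∀ {f} → Computable₁ f → Total 1
fun      (total₁ {f} _) (x ∷ []) = f x
code     (total₁ (c , _))          = c
computes (total₁ (_ , p)) (x ∷ []) = to (p x _) refl

computable₁ : (t : Total 1) → Computable₁ λ x → fun t (x ∷ [])
computable₁ t = code t , λ x y → mk⇔
  (λ { refl → computes t (x ∷ []) })
  (deterministic (code t) (x ∷ []) (computes t (x ∷ [])))

-- Computably enumerable sets

-- Totality provides the values below the least zero, so any zero makes the minimisation halt.
⟦μ⟧⇔ : ∀ (t : Total (1 + n)) xs →
  (∃[ y ] ⟦ μ (code t) ⟧ xs y) ⇔ (∃[ y ] fun t (y ∷ xs) ≡ 0)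
⟦μ⟧⇔ t xs = mk⇔
  (λ { (y , ⟦t⟧ , _) → y ,
     deterministic (code t) (y ∷ xs) (computes t (y ∷ xs)) ⟦t⟧ })
  (λ { (y , eq) → least-zero y 0 (λ _ ())
     (trans (cong h (+-identityʳ y)) eq) })
  where
  h : ℕ → ℕ
  h y = fun t (y ∷ xs)

  -- `d` is the distance from the candidate `j` to a known zero and shrinks as `j` moves up.
  least-zero : ∀ d j →
    (∀ i → i < j → ∃[ z ] ⟦ code t ⟧ (i ∷ xs) (suc z)) → h (d + j) ≡ 0 →
    ∃[ y ] ⟦ μ (code t) ⟧ xs y
  least-zero d j below eq with h j in hj | computes t (j ∷ xs)
  least-zero d       j below eq | zero  | ⟦t⟧ = j , ⟦t⟧ , below
  least-zero zero    j below eq | suc z | ⟦t⟧ =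
    contradiction (trans (sym eq) hj) λ ()
  least-zero (suc d) j below eq | suc z | ⟦t⟧ =
    least-zero d (suc j) below′ (trans (cong h (+-suc d j)) eq)
    where
    below′ : ∀ i → i < suc j → ∃[ z ] ⟦ code t ⟧ (i ∷ xs) (suc z)
    below′ i i<1+j with m<1+n⇒m<n∨m≡n i<1+j
    ... | inj₁ i<j  = below i i<j
    ... | inj₂ refl = z , ⟦t⟧

Σ⁰₁⇒CE : IsΣ⁰₁ A → IsCE A
Σ⁰₁⇒CE (R , (c , p) , A⇔R) = μ (code t) , λ x → mk⇔
  (λ x∈A → let y , Rxy = to (A⇔R x) x∈A in
    from (⟦μ⟧⇔ t (x ∷ [])) (y , T⇒≡0 (R x y) Rxy))
  (λ halts → let y , eq = to (⟦μ⟧⇔ t (x ∷ [])) halts in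
    from (A⇔R x) (y , ≡0⇒T (R x y) eq))
  where
  χ : Total 2
  fun      χ (x ∷ y ∷ []) = if R x y then 1 else 0
  code     χ              = c
  computes χ (x ∷ y ∷ []) = to (p x y _) refl

  t : Total 2
  -- `μ` seeks a zero in its first argument, so truth becomes 0 and the witness comes first.
  t = if₀ (χ ⟨ v₁ ∷ᵗ v₀ ∷ᵗ []ᵗ ⟩) (constᵗ 1) (constᵗ 0)

  T⇒≡0 : ∀ b → T b → ifz (if b then 1 else 0) 1 0 ≡ 0
  T⇒≡0 true _ = refl

  ≡0⇒T : ∀ b → ifz (if b then 1 else 0) 1 0 ≡ 0 → T b
  ≡0⇒T true _ = tt

zeros-Σ⁰₁ : (t : Total 2) → IsΣ⁰₁ λ x → ∃[ y ] fun t (x ∷ y ∷ []) ≡ 0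
zeros-Σ⁰₁ t =
  (λ x y → fun t (x ∷ y ∷ []) ≡ᵇ 0) ,
  (code χ , λ x y z → mk⇔
    (λ { refl → χ-computes x y })
    (deterministic (code χ) (x ∷ y ∷ []) (χ-computes x y))) ,
  λ x → mk⇔
    (λ { (y , eq) → y , ≡⇒≡ᵇ _ 0 eq })
    (λ { (y , Rxy) → y , ≡ᵇ⇒≡ _ 0 Rxy })
  where
  χ : Total 2
  χ = if₀ t (constᵗ 1) (constᵗ 0)

  ifz≡if : ∀ k → ifz k 1 0 ≡ (if k ≡ᵇ 0 then 1 else 0)
  ifz≡if zero    = refl
  ifz≡if (suc k) = refl

  χ-computes : ∀ x y →
    ⟦ code χ ⟧ (x ∷ y ∷ []) (if fun t (x ∷ y ∷ []) ≡ᵇ 0 then 1 else 0)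
  χ-computes x y = subst (⟦ code χ ⟧ (x ∷ y ∷ []))
    (ifz≡if (fun t (x ∷ y ∷ []))) (computes χ (x ∷ y ∷ []))

≤₁⇒≤ₘ : A ≤₁ B → A ≤ₘ B
≤₁⇒≤ₘ (f , f-computable , _ , A⇔B) = f , f-computable , A⇔B

-- Expanding reductions

_≤↑_ : Pred ℕ 0ℓ → Pred ℕ 0ℓ → Set
A ≤↑ B = Σ (ℕ → ℕ) λ f → Computable₁ f × Injective _≡_ _≡_ f ×
           (∀ x → x < f x) × (∀ x → x ∈ A ⇔ f x ∈ B)

module Climbing
  {s q : ℕ → ℕ} (s-computable : Computable₁ s) (q-computable : Computable₁ q)
  (s-injective : Injective _≡_ _≡_ s) (q-injective : Injective _≡_ _≡_ q)
  (disjoint : ∀ x v → s x ≢ q v) where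

  orbit : ℕ → ℕ → ℕ
  orbit x zero    = s x
  orbit x (suc k) = q (orbit x k)

  -- Cancelling `q` on both sides leads to two values of `s`, or to a value of `s` meeting one of
  -- `q`, which disjointness excludes.
  orbit-injective : ∀ {x y} j k → orbit x j ≡ orbit y k → x ≡ y × j ≡ k
  orbit-injective zero    zero    eq = s-injective eq , refl
  orbit-injective zero    (suc k) eq = contradiction eq (disjoint _ _)
  orbit-injective (suc j) zero    eq = contradiction (sym eq) (disjoint _ _)
  orbit-injective (suc j) (suc k) eq with orbit-injective j k (q-injective eq)
  ... | x≡y , j≡k = x≡y , cong suc j≡k

  -- Pigeonhole: 2 + x distinct terms do not fit among the 1 + x numbers up to x.
  orbit-unbounded : ∀ x → ¬ (∀ j → j < 2 + x → orbit x j ≤ x)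
  orbit-unbounded x bounded = n≮n (suc x) (injective⇒≤ {f = f} f-injective)
    where
    f : Fin (2 + x) → Fin (1 + x)
    f i = fromℕ< (s≤s (bounded (toℕ i) (toℕ<n i)))

    f-injective : Injective _≡_ _≡_ f
    f-injective {i} {j} eq = toℕ-injective (proj₂
      (orbit-injective (toℕ i) (toℕ j)
        (trans (sym (toℕ-fromℕ< _)) (trans (cong toℕ eq) (toℕ-fromℕ< _)))))

  -- `q` is applied only while the current value is at most x; a larger value is kept.
  climbᵗ : Total 2
  climbᵗ = recᵗ (total₁ s-computable)
    (if₀ (∸ᵗ ⟨ v₁ ∷ᵗ v₂ ∷ᵗ []ᵗ ⟩) (total₁ q-computable ⟨ v₁ ∷ᵗ []ᵗ ⟩) v₁)

  climb : ℕ → ℕ → ℕ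
  climb x k = fun climbᵗ (k ∷ x ∷ [])

  climb-orbit : ∀ x k → ∃[ j ] climb x k ≡ orbit x j
  climb-orbit x zero    = 0 , refl
  climb-orbit x (suc k) with climb x k ∸ x | climb-orbit x k
  ... | zero  | j , eq = suc j , cong q eq
  ... | suc _ | j , eq = j , eq

  -- In the second case no step has been idle yet; at k = 2 + x it is refuted by `orbit-unbounded`.
  climb-progress : ∀ x k → x < climb x k ⊎
    (∀ j → j < k → orbit x j ≤ x) × climb x k ≡ orbit x k
  climb-progress x zero    = inj₂ ((λ _ ()) , refl)
  climb-progress x (suc k) with climb x k ∸ x in eq | climb-progress x k
  ... | suc _ | _ = inj₁ (m∸n≢0⇒n<m λ eq₀ → 0≢1+n (trans (sym eq₀) eq))
  ... | zero  | inj₁ x<climb = contradiction (m∸n≡0⇒m≤n eq) (<⇒≱ x<climb)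
  ... | zero  | inj₂ (bounded , climb≡) = inj₂ (bounded′ , cong q climb≡)
    where
    bounded′ : ∀ j → j < suc k → orbit x j ≤ x
    bounded′ j j<1+k with m<1+n⇒m<n∨m≡n j<1+k
    ... | inj₁ j<k  = bounded j j<k
    ... | inj₂ refl = subst (_≤ x) climb≡ (m∸n≡0⇒m≤n eq)

  summitᵗ : Total 1
  summitᵗ = climbᵗ ⟨ sucᵗ ⟨ sucᵗ ∷ᵗ []ᵗ ⟩ ∷ᵗ v₀ ∷ᵗ []ᵗ ⟩

  summit : ℕ → ℕ
  summit x = climb x (2 + x)

  summit-expanding : ∀ x → x < summit x
  summit-expanding x with climb-progress x (2 + x)
  ... | inj₁ x<climb       = x<climb
  ... | inj₂ (bounded , _) = contradiction bounded (orbit-unbounded x)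

  -- The number of steps taken may differ, but orbits of distinct starting points are disjoint.
  summit-injective : Injective _≡_ _≡_ summit
  summit-injective {x} {y} eq
    with climb-orbit x (2 + x) | climb-orbit y (2 + y)
  ... | j , eq₁ | k , eq₂ =
    proj₁ (orbit-injective j k (trans (sym eq₁) (trans eq eq₂)))

  summit-reduces : (∀ x → x ∈ A ⇔ s x ∈ B) → (∀ v → v ∈ B ⇔ q v ∈ B) →
    ∀ x → x ∈ A ⇔ summit x ∈ B
  summit-reduces {A} {B} s-reduces q-reduces x with climb-orbit x (2 + x)
  ... | j , eq = mk⇔
    (λ x∈A → subst B (sym eq) (to (orbit-reduces j) x∈A))
    (λ ∈B → from (orbit-reduces j) (subst B eq ∈B))
    where
    orbit-reduces : ∀ j → x ∈ A ⇔ orbit x j ∈ B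
    orbit-reduces zero    = s-reduces x
    orbit-reduces (suc j) = mk⇔
      (λ x∈A → to (q-reduces _) (to (orbit-reduces j) x∈A))
      (λ ∈B → from (orbit-reduces j) (from (q-reduces _) ∈B))

-- Schröder–Bernstein for expanding reductions

-- The range of an expanding injection is decidable: `preimage f y` is 0 if y
-- has no preimage and 1 + x if f x = y.
module Preimage {f : ℕ → ℕ} (f-computable : Computable₁ f)
  (f-injective : Injective _≡_ _≡_ f) (f-expanding : ∀ x → x < f x) where

  preimageBelowᵗ : Total 2
  preimageBelowᵗ = recᵗ (constᵗ 0)
    (if₀ (distᵗ ⟨ total₁ f-computable ⟨ v₀ ∷ᵗ []ᵗ ⟩ ∷ᵗ v₂ ∷ᵗ []ᵗ ⟩)
      (sucᵗ ⟨ v₀ ∷ᵗ []ᵗ ⟩) v₁)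

  preimageᵗ : Total 1
  -- Since `f` is expanding, a preimage of y lies below y, so y itself bounds the search.
  preimageᵗ = preimageBelowᵗ ⟨ v₀ ∷ᵗ v₀ ∷ᵗ []ᵗ ⟩

  preimage : ℕ → ℕ
  preimage y = fun preimageᵗ (y ∷ [])

  preimage-sound : ∀ y {x} → preimage y ≡ suc x → f x ≡ y
  preimage-sound y = go y
    where
    go : ∀ k {x} → fun preimageBelowᵗ (k ∷ y ∷ []) ≡ suc x → f x ≡ y
    go (suc k) eq with ∣ f k - y ∣ in d
    go (suc k) refl | zero  = ∣m-n∣≡0⇒m≡n d
    go (suc k) eq   | suc _ = go k eq

  preimage-f : ∀ x → preimage (f x) ≡ suc x
  preimage-f x = go (f x) (f-expanding x)
    where
    go : ∀ k → x < k → fun preimageBelowᵗ (k ∷ f x ∷ []) ≡ suc x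
    go (suc k) x<1+k with ∣ f k - f x ∣ in d | m<1+n⇒m<n∨m≡n x<1+k
    ... | zero  | _         = cong suc (f-injective (∣m-n∣≡0⇒m≡n d))
    ... | suc _ | inj₁ x<k  = go k x<k
    ... | suc _ | inj₂ refl = contradiction (trans (sym d) (∣n-n∣≡0 (f x))) λ ()

module SchröderBernstein {A B : Pred ℕ 0ℓ} (A≤B : A ≤↑ B) (B≤A : B ≤↑ A) where

  f g : ℕ → ℕ
  f = proj₁ A≤B
  g = proj₁ B≤A

  f-injective : Injective _≡_ _≡_ f
  f-injective = proj₁ (proj₂ (proj₂ A≤B))

  g-injective : Injective _≡_ _≡_ g
  g-injective = proj₁ (proj₂ (proj₂ B≤A))

  f-expanding : ∀ x → x < f x
  f-expanding = proj₁ (proj₂ (proj₂ (proj₂ A≤B)))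

  g-expanding : ∀ x → x < g x
  g-expanding = proj₁ (proj₂ (proj₂ (proj₂ B≤A)))

  f-reduces : ∀ x → x ∈ A ⇔ f x ∈ B
  f-reduces = proj₂ (proj₂ (proj₂ (proj₂ A≤B)))

  g-reduces : ∀ y → y ∈ B ⇔ g y ∈ A
  g-reduces = proj₂ (proj₂ (proj₂ (proj₂ B≤A)))

  module F = Preimage (proj₁ (proj₂ A≤B)) f-injective f-expanding
  module G = Preimage (proj₁ (proj₂ B≤A)) g-injective g-expanding

  -- `Origin x 0` and `Origin x 1` say that the backward chain x, g⁻¹ x,
  -- f⁻¹ (g⁻¹ x), … stops outside the range of g, respectively of f.
  data Origin (x : ℕ) : ℕ → Set where
    outside-g : G.preimage x ≡ 0 → Origin x 0
    outside-f : ∀ {y} → G.preimage x ≡ suc y → F.preimage y ≡ 0 → Origin x 1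
    back      : ∀ {y x′ c} → G.preimage x ≡ suc y → F.preimage y ≡ suc x′ →
                Origin x′ c → Origin x c

  origin-unique : ∀ {x c d} → Origin x c → Origin x d → c ≡ d
  origin-unique (outside-g _)    (outside-g _)     = refl
  origin-unique (outside-f _ _)  (outside-f _ _)   = refl
  origin-unique (outside-g eq)   (outside-f eq′ _) with trans (sym eq) eq′
  ... | ()
  origin-unique (outside-g eq)   (back eq′ _ _)    with trans (sym eq) eq′
  ... | ()
  origin-unique (outside-f eq _) (outside-g eq′)   with trans (sym eq) eq′
  ... | ()
  origin-unique (back eq _ _)    (outside-g eq′)   with trans (sym eq) eq′
  ... | ()
  origin-unique (outside-f eq₁ eq₂) (back eq₁′ eq₂′ _)
    with trans (sym eq₁) eq₁′
  ... | refl with trans (sym eq₂) eq₂′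
  ... | ()
  origin-unique (back eq₁ eq₂ _) (outside-f eq₁′ eq₂′)
    with trans (sym eq₁) eq₁′
  ... | refl with trans (sym eq₂) eq₂′
  ... | ()
  origin-unique (back eq₁ eq₂ o) (back eq₁′ eq₂′ o′)
    with trans (sym eq₁) eq₁′
  ... | refl with trans (sym eq₂) eq₂′
  ... | refl = origin-unique o o′

  -- This keeps the two branches of the bijection from sharing a value: `f x` pulled back along `g`
  -- would have origin 0 and 1 at once.
  origin-gf : ∀ {x c} → Origin x c → Origin (g (f x)) c
  origin-gf = back (G.preimage-f _) (F.preimage-f _)

  -- The states 0 and 1 are final and record the origin; 2 + x means that the
  -- backward chain has reached x.
  stepᵗ : Total 1
  stepᵗ = if₀ v₀ (constᵗ 0)
    (if₀ (predᵗ ⟨ v₀ ∷ᵗ []ᵗ ⟩) (constᵗ 1)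
      (if₀ g⁻¹x (constᵗ 0)
        (if₀ f⁻¹g⁻¹x (constᵗ 1) (sucᵗ ⟨ f⁻¹g⁻¹x ∷ᵗ []ᵗ ⟩))))
    where
    g⁻¹x f⁻¹g⁻¹x : Total 1
    g⁻¹x    = G.preimageᵗ ⟨ predᵗ ⟨ predᵗ ∷ᵗ []ᵗ ⟩ ∷ᵗ []ᵗ ⟩
    f⁻¹g⁻¹x = F.preimageᵗ ⟨ predᵗ ⟨ g⁻¹x ∷ᵗ []ᵗ ⟩ ∷ᵗ []ᵗ ⟩

  chaseᵗ : Total 2
  chaseᵗ = recᵗ (sucᵗ ⟨ sucᵗ ∷ᵗ []ᵗ ⟩) (stepᵗ ⟨ v₁ ∷ᵗ []ᵗ ⟩)

  chase : ℕ → ℕ → ℕ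
  chase k x = fun chaseᵗ (k ∷ x ∷ [])

  -- Invariant of the chase: each round lowers the current element, and an origin of that element is
  -- carried back to x.
  Reached : ℕ → ℕ → ℕ → Set
  Reached x k zero           = Origin x 0
  Reached x k (suc zero)     = Origin x 1
  Reached x k (suc (suc x′)) = x′ + k ≤ x × (∀ {c} → Origin x′ c → Origin x c)

  chase-reached : ∀ k x → Reached x k (chase k x)
  chase-reached zero    x = ≤-reflexive (+-identityʳ x) , id
  chase-reached (suc k) x with chase k x | chase-reached k x
  ... | zero        | o = o
  ... | suc zero    | o = o
  ... | suc (suc x₁) | x₁+k≤x , transport with G.preimage x₁ in eq₁
  ...   | zero  = transport (outside-g eq₁)
  ...   | suc y with F.preimage y in eq₂
  ...     | zero   = transport (outside-f eq₁ eq₂)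
  ...     | suc x₂ = ≤-trans (≤-reflexive (+-suc x₂ k))
                       (≤-trans (+-monoˡ-≤ k x₂<x₁) x₁+k≤x)
                   , transport ∘ back eq₁ eq₂
    where
    x₂<x₁ : x₂ < x₁
    x₂<x₁ = subst (x₂ <_)
      (trans (cong g (F.preimage-sound y eq₂)) (G.preimage-sound x₁ eq₁))
      (<-trans (f-expanding x₂) (g-expanding (f x₂)))

  originᵗ : Total 1
  -- After 1 + x rounds a running chain would give x′ + (1 + x) ≤ x, so the state is final.
  originᵗ = chaseᵗ ⟨ sucᵗ ∷ᵗ v₀ ∷ᵗ []ᵗ ⟩

  hᵗ : Total 1
  -- The second branch is selected only in the range of `g`, where `pred` of the preimage code is
  -- g⁻¹ x.
  hᵗ = if₀ originᵗ (total₁ (proj₁ (proj₂ A≤B))) (predᵗ ⟨ G.preimageᵗ ∷ᵗ []ᵗ ⟩)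

  h : ℕ → ℕ
  h x = fun hᵗ (x ∷ [])

  -- Relational form of `h`, which turns bijectivity into case analysis on origins instead of on
  -- encoded states.
  data Graph (x : ℕ) : ℕ → Set where
    forward  : Origin x 0 → Graph x (f x)
    backward : ∀ {y} → Origin x 1 → g y ≡ x → Graph x y

  in-range-g : ∀ {x} → Origin x 1 → ∃[ y ] G.preimage x ≡ suc y
  in-range-g (outside-f eq _) = _ , eq
  in-range-g (back eq _ _)    = _ , eq

  h-graph : ∀ x → Graph x (h x)
  h-graph x with chase (suc x) x | chase-reached (suc x) x
  ... | zero         | o = forward o
  ... | suc zero     | o with in-range-g o
  ...   | y , eq =
    backward o (trans (cong (g ∘ pred) eq) (G.preimage-sound x eq))
  h-graph x | suc (suc x′) | x′+1+x≤x , _ =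
    contradiction (≤-trans (m≤n+m (suc x) x′) x′+1+x≤x) (n≮n x)

  graph-functional : ∀ {x y y′} → Graph x y → Graph x y′ → y ≡ y′
  graph-functional (forward _)    (forward _)    = refl
  graph-functional (forward o)    (backward p _) =
    contradiction (origin-unique o p) λ ()
  graph-functional (backward o _) (forward p)    =
    contradiction (origin-unique o p) λ ()
  graph-functional (backward _ gy≡x) (backward _ gy′≡x) =
    g-injective (trans gy≡x (sym gy′≡x))

  graph-injective : ∀ {x x′ y y′} → Graph x y → Graph x′ y′ → y ≡ y′ → x ≡ x′
  graph-injective (forward _)      (forward _)       fx≡fx′ = f-injective fx≡fx′
  graph-injective (backward _ eq)  (backward _ eq′)  refl   = trans (sym eq) eq′
  graph-injective (forward o)      (backward p refl) refl   =
    contradiction (origin-unique (origin-gf o) p) λ ()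
  graph-injective (backward p refl) (forward o)      refl   =
    contradiction (origin-unique (origin-gf o) p) λ ()

  -- The origin of `g y` decides: if it is 1, then y is the image of `g y`; if it is 0, then y is
  -- `f x′` for some x′ of origin 0.
  graph-surjective : ∀ y → ∃[ x ] Graph x y
  graph-surjective y with h (g y) | h-graph (g y)
  ... | _ | backward o _ = g y , backward o refl
  ... | _ | forward (outside-g eq) =
    contradiction (trans (sym eq) (G.preimage-f y)) λ ()
  ... | _ | forward (back {x′ = x′} eq₁ eq₂ o)
    with trans (sym eq₁) (G.preimage-f y)
  ... | refl = x′ , subst (Graph x′) (F.preimage-sound y eq₂) (forward o)

  graph-reduces : ∀ {x y} → Graph x y → x ∈ A ⇔ y ∈ B
  graph-reduces (forward _)           = f-reduces _
  graph-reduces (backward {y} _ refl) = mk⇔ (from (g-reduces y)) (to (g-reduces y))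

  h-surjective : ∀ y → ∃[ x ] h x ≡ y
  h-surjective y with graph-surjective y
  ... | x , graph = x , graph-functional (h-graph x) graph

  isomorphic : ComputablyIsomorphic A B
  isomorphic =
    mk⤖ ((λ {x} {x′} → graph-injective (h-graph x) (h-graph x′)) ,
         λ y → let x , hx≡y = h-surjective y in x , λ { refl → hx≡y }) ,
    computable₁ hᵗ ,
    λ y → mk⇔
      (λ y∈B → let x , hx≡y = h-surjective y in
        x , from (graph-reduces (h-graph x)) (subst B (sym hx≡y) y∈B) , hx≡y)
      (λ { (x , x∈A , refl) → to (graph-reduces (h-graph x)) x∈A })

-- Parity

parityᵗ halfᵗ doubleᵗ : Total 1
parityᵗ = recᵗ (constᵗ 0) (if₀ v₁ (constᵗ 1) (constᵗ 0))
halfᵗ   = recᵗ (constᵗ 0) (if₀ (parityᵗ ⟨ v₀ ∷ᵗ []ᵗ ⟩) v₁ (sucᵗ ⟨ v₁ ∷ᵗ []ᵗ ⟩))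
doubleᵗ = recᵗ (constᵗ 0) (sucᵗ ⟨ sucᵗ ⟨ v₁ ∷ᵗ []ᵗ ⟩ ∷ᵗ []ᵗ ⟩)

parity half double : ℕ → ℕ
parity x = fun parityᵗ (x ∷ [])
half   x = fun halfᵗ (x ∷ [])
double x = fun doubleᵗ (x ∷ [])

parity-double : ∀ x → parity (double x) ≡ 0
parity-double zero    = refl
parity-double (suc x) rewrite parity-double x = refl

parity-1+double : ∀ x → parity (suc (double x)) ≡ 1
parity-1+double x rewrite parity-double x = refl

half-double : ∀ x → half (double x) ≡ x
half-double zero    = refl
half-double (suc x) rewrite parity-double x = cong suc (half-double x)

half-1+double : ∀ x → half (suc (double x)) ≡ x
half-1+double x rewrite parity-double x = half-double x

double-injective : Injective _≡_ _≡_ double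
double-injective {x} {y} eq =
  trans (sym (half-double x)) (trans (cong half eq) (half-double y))

double≢1+double : ∀ x y → double x ≢ suc (double y)
double≢1+double x y eq = contradiction
  (trans (sym (parity-double x)) (trans (cong parity eq) (parity-1+double y))) λ ()

-- Acceptable numberings

module Acceptable {φ : ℕ → ℕ → ℕ → Set} (acceptable : IsAcceptable φ) where

  open IsAcceptable acceptable

  U : Code 2
  U = proj₁ universal

  U-correct : ∀ e x y → φ e x y ⇔ ⟦ U ⟧ (e ∷ x ∷ []) y
  U-correct = proj₂ universal

  φ-deterministic : ∀ {e x y y′} → φ e x y → φ e x y′ → y ≡ y′
  φ-deterministic {e} {x} p q = deterministic U (e ∷ x ∷ [])
    (to (U-correct e x _) p) (to (U-correct e x _) q)

  ⟦comp-U⟧⇔ : ∀ (gs : Vec (Code n) 2) {xs e x} → ⟦ gs ⟧* xs (e ∷ x ∷ []) →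
    ∀ {y} → ⟦ comp U gs ⟧ xs y ⇔ φ e x y
  ⟦comp-U⟧⇔ gs ⟦gs⟧ = mk⇔
    (λ p → from (U-correct _ _ _) (to (⟦comp⟧⇔ U gs ⟦gs⟧) p))
    (λ p → from (⟦comp⟧⇔ U gs ⟦gs⟧) (to (U-correct _ _ _) p))

  index : (c : Code 1) → ∃[ e ] ∀ x y → φ e x y ⇔ ⟦ c ⟧ (x ∷ []) y
  index c = surjective (λ x → ⟦ c ⟧ (x ∷ [])) (c , λ _ _ → mk⇔ id id)

  parametrise : (c : Code 2) → Σ (ℕ → ℕ) λ s → Computable₁ s ×
    (∀ w x y → φ (s w) x y ⇔ ⟦ c ⟧ (w ∷ x ∷ []) y)
  parametrise c = s-m-n (λ w x → ⟦ c ⟧ (w ∷ x ∷ [])) (c , λ _ _ _ → mk⇔ id id)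

  -- Composition is strict, so the constant 1 composed with a code for A still diverges outside A.
  constant-one : IsCE A → ∃[ a ] ∀ w y → φ a w y ⇔ (w ∈ A × y ≡ 1)
  constant-one (c , A⇔c) with index (comp (code (constᵗ {n = 1} 1)) (c ∷ []))
  ... | a , a-correct = a , λ w y → mk⇔
    (λ p → convergent w (to (a-correct w y) p))
    (λ { (w∈A , refl) → let z , ⟦c⟧ = to (A⇔c w) w∈A in
         from (a-correct w 1)
           (z ∷ [] , (⟦c⟧ , tt) , computes (constᵗ 1) (z ∷ [])) })
    where
    convergent : ∀ w {y} →
      ⟦ comp (code (constᵗ {n = 1} 1)) (c ∷ []) ⟧ (w ∷ []) y → _ × y ≡ 1
    convergent w (z ∷ [] , (⟦c⟧ , tt) , ⟦1⟧) = from (A⇔c w) (z , ⟦c⟧) ,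
      deterministic (code (constᵗ 1)) (z ∷ []) ⟦1⟧ (computes (constᵗ 1) (z ∷ []))

  identity : ∃[ b ] ∀ w y → φ b w y ⇔ w ≡ y
  identity = index (proj zero)

  -- 1-completeness of M and K

  M-Σ⁰₁ : IsΣ⁰₁ (M φ)
  M-Σ⁰₁ = let R , R-computable , zeros = zeros-Σ⁰₁ t in
    R , R-computable , λ p → mk⇔
      (λ p∈M → to (zeros p) (bound (to (U-correct p 0 1) p∈M)))
      (λ halts → let k , eq = from (zeros p) halts in
        from (U-correct p 0 1) (eval-sound U k (p ∷ 0 ∷ []) (∣m-n∣≡0⇒m≡n eq)))
    where
    t : Total 2
    -- The witness is the fuel; `evalᵗ` reports the value 1 as 2.
    t = distᵗ ⟨ evalᵗ U ⟨ v₁ ∷ᵗ v₀ ∷ᵗ constᵗ 0 ∷ᵗ []ᵗ ⟩ ∷ᵗ constᵗ 2 ∷ᵗ []ᵗ ⟩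

    bound : ∀ {p} → ⟦ U ⟧ (p ∷ 0 ∷ []) 1 → ∃[ k ] fun t (p ∷ k ∷ []) ≡ 0
    bound ⟦U⟧ with eval-complete U _ ⟦U⟧
    ... | k , eq = k , m≡n⇒∣m-n∣≡0 (eq k ≤-refl)

  K-CE : IsCE (K φ)
  K-CE = comp U (codes diagonal) , λ e →
    let K⇔U = λ y → ⟦comp-U⟧⇔ (codes diagonal) (computes* diagonal (e ∷ [])) {y} in
    mk⇔ (λ { (y , p) → y , from (K⇔U y) p }) (λ { (y , p) → y , to (K⇔U y) p })
    where
    diagonal : TotalMap 1 2
    diagonal = v₀ ∷ᵗ v₀ ∷ᵗ []ᵗ

  CE⇒≤₁M : IsCE A → A ≤₁ M φ
  CE⇒≤₁M {A} A-CE = s , s-computable , s-injective ,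
    λ w → mk⇔
      (λ w∈A → from (s-correct w 0 1) (from (a-correct w 1) (w∈A , refl)))
      (λ p → proj₁ (to (a-correct w 1) (to (s-correct w 0 1) p)))
    where
    a b : ℕ
    a = proj₁ (constant-one A-CE)
    b = proj₁ identity

    a-correct : ∀ w y → φ a w y ⇔ (w ∈ A × y ≡ 1)
    a-correct = proj₂ (constant-one A-CE)

    σ : TotalMap 2 2
    -- Selecting an index keeps the possibly divergent run of `a` away from nonzero arguments.
    σ = if₀ v₁ (constᵗ a) (constᵗ b) ∷ᵗ v₀ ∷ᵗ []ᵗ

    s : ℕ → ℕ
    s = proj₁ (parametrise (comp U (codes σ)))

    s-computable : Computable₁ s
    s-computable = proj₁ (proj₂ (parametrise (comp U (codes σ))))

    s-correct : ∀ w x y → φ (s w) x y ⇔ φ (ifz x a b) w y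
    s-correct w x y = mk⇔
      (λ p → to (⟦comp-U⟧⇔ (codes σ) (computes* σ _)) (to (spec w x y) p))
      (λ p → from (spec w x y) (from (⟦comp-U⟧⇔ (codes σ) (computes* σ _)) p))
      where spec = proj₂ (proj₂ (parametrise (comp U (codes σ))))

    s-recovers : ∀ w → φ (s w) 1 w
    s-recovers w = from (s-correct w 1 w) (from (proj₂ identity w w) refl)

    s-injective : Injective _≡_ _≡_ s
    s-injective {w} {v} eq = φ-deterministic
      (subst (λ e → φ e 1 w) eq (s-recovers w)) (s-recovers v)

  -- The recursion theorem with one parameter.  The index α w codes the pair
  -- of w and an index e of r, so that r can reconstruct its own value.
  self-referential : ∀ a b → Σ (ℕ → ℕ) λ s → Computable₁ s ×
    (∀ w x y → φ (s w) x y ⇔ φ (ifz ∣ x - s w ∣ a b) w y)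
  self-referential a b =
    (λ w → r (α w)) ,
    computable₁ (total₁ r-computable ⟨ total₁ α-computable ∷ᵗ []ᵗ ⟩) ,
    λ w x y → mk⇔
      (λ p → to (⟦comp-U⟧⇔ body (⟦body⟧ w x)) (to (r-spec (α w) x y) p))
      (λ p → from (r-spec (α w) x y) (from (⟦comp-U⟧⇔ body (⟦body⟧ w x)) p))
    where
    parameter program self : Code 2
    parameter = comp U (code v₀ ∷ code (constᵗ 0) ∷ [])
    program   = comp U (code v₀ ∷ code (constᵗ 1) ∷ [])
    -- On input u this runs φ with index φ_u(1) at u; for u = `α w` that index is `e`, so the result
    -- is `r u`.
    self      = comp U (program ∷ code v₀ ∷ [])

    select : Total 2
    select = if₀ distᵗ (constᵗ a) (constᵗ b)

    body : Vec (Code 2) 2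
    body = comp (code select) (code v₁ ∷ self ∷ []) ∷ parameter ∷ []

    r : ℕ → ℕ
    r = proj₁ (parametrise (comp U body))

    r-computable : Computable₁ r
    r-computable = proj₁ (proj₂ (parametrise (comp U body)))

    r-spec : ∀ u x y → φ (r u) x y ⇔ ⟦ comp U body ⟧ (u ∷ x ∷ []) y
    r-spec = proj₂ (proj₂ (parametrise (comp U body)))

    e : ℕ
    e = proj₁ (index (proj₁ r-computable))

    φ-e : ∀ u → φ e u (r u)
    φ-e u = from (proj₂ (index (proj₁ r-computable)) u (r u))
      (to (proj₂ r-computable u (r u)) refl)

    pair : Total 2
    -- The value at 0 is w and every other value is `e`; `r` is already fixed, so its index can be
    -- stored here.
    pair = if₀ v₁ v₀ (constᵗ e)

    α : ℕ → ℕ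
    α = proj₁ (parametrise (code pair))

    α-computable : Computable₁ α
    α-computable = proj₁ (proj₂ (parametrise (code pair)))

    φ-α : ∀ w x → φ (α w) x (ifz x w e)
    φ-α w x = from (proj₂ (proj₂ (parametrise (code pair))) w x _)
      (computes pair (w ∷ x ∷ []))

    ⟦body⟧ : ∀ w x → ⟦ body ⟧* (α w ∷ x ∷ [])
      (ifz ∣ x - r (α w) ∣ a b ∷ w ∷ [])
    ⟦body⟧ w x =
      (x ∷ r (α w) ∷ [] , (refl , ⟦self⟧ , tt) , computes select _) ,
      from (⟦comp-U⟧⇔ _ (refl , computes (constᵗ 0) (α w ∷ x ∷ []) , tt)) (φ-α w 0) ,
      tt
      where
      ⟦self⟧ : ⟦ self ⟧ (α w ∷ x ∷ []) (r (α w))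
      ⟦self⟧ = from (⟦comp-U⟧⇔ _
          (from (⟦comp-U⟧⇔ _
              (refl , computes (constᵗ 1) (α w ∷ x ∷ []) , tt)) (φ-α w 1) ,
            refl , tt))
        (φ-e (α w))

  CE⇒≤₁K : IsCE A → A ≤₁ K φ
  CE⇒≤₁K {A} A-CE = s , s-computable , s-injective ,
    λ w → mk⇔
      (λ w∈A → 1 , from (s-correct w (s w) 1)
        (subst (λ i → φ i w 1) (sym (ifz-≡ {s w} refl a b))
          (from (a-correct w 1) (w∈A , refl))))
      (λ { (y , p) → proj₁ (to (a-correct w y)
        (subst (λ i → φ i w y) (ifz-≡ {s w} refl a b)
          (to (s-correct w (s w) y) p))) })
    where
    a b : ℕ
    a = proj₁ (constant-one A-CE)
    b = proj₁ identity

    a-correct : ∀ w y → φ a w y ⇔ (w ∈ A × y ≡ 1)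
    a-correct = proj₂ (constant-one A-CE)

    s : ℕ → ℕ
    s = proj₁ (self-referential a b)

    s-computable : Computable₁ s
    s-computable = proj₁ (proj₂ (self-referential a b))

    s-correct : ∀ w x y → φ (s w) x y ⇔ φ (ifz ∣ x - s w ∣ a b) w y
    s-correct = proj₂ (proj₂ (self-referential a b))

    s-recovers : ∀ w {x} → x ≢ s w → φ (s w) x w
    s-recovers w {x} x≢sw = from (s-correct w x w)
      (subst (λ i → φ i w w) (sym (ifz-≢ x≢sw a b))
        (from (proj₂ identity w w) refl))

    s-injective : Injective _≡_ _≡_ s
    s-injective {w} {v} eq = φ-deterministic
      -- The argument `suc (s w)` is off the diagonal for both indices, as they coincide.
      (subst (λ e → φ e (suc (s w)) w) eq (s-recovers w 1+n≢n))
      (s-recovers v λ eq′ → 1+n≢n (trans eq′ (sym eq)))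

  -- The case distinction is made on indices, so that only the relevant
  -- computation is run.
  join-CE : IsCE A → IsCE B →
    Σ (Pred ℕ 0ℓ) λ C → IsCE C ×
      (∀ x → x ∈ A ⇔ double x ∈ C) × (∀ x → x ∈ B ⇔ suc (double x) ∈ C)
  join-CE {A} {B} A-CE B-CE =
    C , (comp U (codes σ) , λ z → mk⇔
      (λ { (y , p) → y , from (⟦comp-U⟧⇔ (codes σ) (computes* σ _)) p })
      (λ { (y , p) → y , to (⟦comp-U⟧⇔ (codes σ) (computes* σ _)) p })) ,
    (λ x → mk⇔
      (λ x∈A → 1 , subst₂ (λ i w → φ i w 1)
        (sym (cong (λ k → ifz k a b) (parity-double x))) (sym (half-double x))
        (from (proj₂ (constant-one A-CE) x 1) (x∈A , refl)))
      (λ { (y , p) → proj₁ (to (proj₂ (constant-one A-CE) x y)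
        (subst₂ (λ i w → φ i w y)
          (cong (λ k → ifz k a b) (parity-double x)) (half-double x) p)) })) ,
    (λ x → mk⇔
      (λ x∈B → 1 , subst₂ (λ i w → φ i w 1)
        (sym (cong (λ k → ifz k a b) (parity-1+double x))) (sym (half-1+double x))
        (from (proj₂ (constant-one B-CE) x 1) (x∈B , refl)))
      (λ { (y , p) → proj₁ (to (proj₂ (constant-one B-CE) x y)
        (subst₂ (λ i w → φ i w y)
          (cong (λ k → ifz k a b) (parity-1+double x)) (half-1+double x) p)) }))
    where
    a b : ℕ
    a = proj₁ (constant-one A-CE)
    b = proj₁ (constant-one B-CE)

    σ : TotalMap 1 2
    σ = if₀ parityᵗ (constᵗ a) (constᵗ b) ∷ᵗ halfᵗ ∷ᵗ []ᵗ

    C : Pred ℕ 0ℓ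
    C z = W φ (ifz (parity z) a b) (half z)

  -- Isomorphism of 1-complete sets

  1-complete⇒≤↑ : 1-Complete B → IsCE A → A ≤↑ B
  1-complete⇒≤↑ {B} {A} (B-CE , B-complete) A-CE =
    summit , computable₁ summitᵗ , summit-injective , summit-expanding ,
    summit-reduces {A} {B}
      (λ x → mk⇔ (λ x∈A → to (r-reduces _) (to (A⇔C x) x∈A))
                 (λ p → from (A⇔C x) (from (r-reduces _) p)))
      (λ v → mk⇔ (λ v∈B → to (r-reduces _) (to (B⇔C v) v∈B))
                 (λ p → from (B⇔C v) (from (r-reduces _) p)))
    where
    join = join-CE {A} {B} A-CE B-CE

    C : Pred ℕ 0ℓ
    C = proj₁ join

    A⇔C : ∀ x → x ∈ A ⇔ double x ∈ C
    A⇔C = proj₁ (proj₂ (proj₂ join))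

    B⇔C : ∀ x → x ∈ B ⇔ suc (double x) ∈ C
    B⇔C = proj₂ (proj₂ (proj₂ join))

    C≤B : C ≤₁ B
    C≤B = B-complete C (proj₁ (proj₂ join))

    r : ℕ → ℕ
    r = proj₁ C≤B

    rᵗ : Total 1
    rᵗ = total₁ (proj₁ (proj₂ C≤B))

    r-injective : Injective _≡_ _≡_ r
    r-injective = proj₁ (proj₂ (proj₂ C≤B))

    r-reduces : ∀ z → z ∈ C ⇔ r z ∈ B
    r-reduces = proj₂ (proj₂ (proj₂ C≤B))

    -- The even and odd halves of the join provide the two maps; injectivity of `r` keeps their
    -- ranges disjoint.
    open Climbing
      (computable₁ (rᵗ ⟨ doubleᵗ ∷ᵗ []ᵗ ⟩))
      (computable₁ (rᵗ ⟨ sucᵗ ⟨ doubleᵗ ∷ᵗ []ᵗ ⟩ ∷ᵗ []ᵗ ⟩))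
      (λ eq → double-injective (r-injective eq))
      (λ eq → double-injective (suc-injective (r-injective eq)))
      (λ x v eq → double≢1+double x v (r-injective eq))

  1-complete⇒isomorphic : 1-Complete A → 1-Complete B → ComputablyIsomorphic A B
  1-complete⇒isomorphic {A} {B} A-complete B-complete =
    SchröderBernstein.isomorphic {A} {B}
      (1-complete⇒≤↑ {B} {A} B-complete (proj₁ A-complete))
      (1-complete⇒≤↑ {A} {B} A-complete (proj₁ B-complete))

  -- If f reduces K to C and φ (g e) = φ e ∘ f, then f (g e) lies in C exactly
  -- when it lies in W e.
  K≤ₘ⇒productive : ∀ C → K φ ≤ₘ C → Productive φ (λ x → x ∉ C)
  K≤ₘ⇒productive C (f , f-computable , K⇔C) =
    (λ e → f (g e)) ,
    computable₁ (total₁ f-computable ⟨ total₁ g-computable ∷ᵗ []ᵗ ⟩) ,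
    -- A point of W e would lie in C by `W⇒C` and outside C by assumption; a point of C would lie in
    -- W e by `C⇒W`.
    λ e We⊆∁C → let p∉We = λ p∈We → We⊆∁C p∈We (W⇒C e p∈We) in
      (λ p∈C → p∉We (C⇒W e p∈C)) , p∉We
    where
    σ : TotalMap 2 2
    σ = v₀ ∷ᵗ total₁ f-computable ⟨ v₁ ∷ᵗ []ᵗ ⟩ ∷ᵗ []ᵗ

    g : ℕ → ℕ
    g = proj₁ (parametrise (comp U (codes σ)))

    g-computable : Computable₁ g
    g-computable = proj₁ (proj₂ (parametrise (comp U (codes σ))))

    g-correct : ∀ e x y → φ (g e) x y ⇔ φ e (f x) y
    g-correct e x y = mk⇔
      (λ p → to (⟦comp-U⟧⇔ (codes σ) (computes* σ _)) (to (spec e x y) p))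
      (λ p → from (spec e x y) (from (⟦comp-U⟧⇔ (codes σ) (computes* σ _)) p))
      where spec = proj₂ (proj₂ (parametrise (comp U (codes σ))))

    W⇒C : ∀ e → f (g e) ∈ W φ e → f (g e) ∈ C
    W⇒C e (y , p) = to (K⇔C (g e)) (y , from (g-correct e (g e) y) p)

    C⇒W : ∀ e → f (g e) ∈ C → f (g e) ∈ W φ e
    C⇒W e p∈C = let y , p = from (K⇔C (g e)) p∈C in y , to (g-correct e (g e) y) p

  -- Completeness and creativity of M

  M-1-complete : 1-Complete (M φ)
  M-1-complete = Σ⁰₁⇒CE {M φ} M-Σ⁰₁ , λ A → CE⇒≤₁M {A}

  K-1-complete : 1-Complete (K φ)
  K-1-complete = K-CE , λ A → CE⇒≤₁K {A}

  M-Σ⁰₁-complete : Σ⁰₁-Complete (M φ)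
  M-Σ⁰₁-complete = M-Σ⁰₁ , λ A A-Σ⁰₁ →
    ≤₁⇒≤ₘ {A} {M φ} (CE⇒≤₁M {A} (Σ⁰₁⇒CE {A} A-Σ⁰₁))

  M-creative : Creative φ (M φ)
  M-creative = proj₁ M-1-complete ,
    K≤ₘ⇒productive (M φ) (≤₁⇒≤ₘ {K φ} {M φ} (CE⇒≤₁M {K φ} K-CE))

proposition7p1 : (φ : ℕ → ℕ → ℕ → Set) → IsAcceptable φ →
    Σ⁰₁-Complete (M φ) × 1-Complete (M φ) × Creative φ (M φ) × ComputablyIsomorphic (M φ) (K φ)
proposition7p1 φ acceptable =
  M-Σ⁰₁-complete , M-1-complete , M-creative ,
  1-complete⇒isomorphic {M φ} {K φ} M-1-complete K-1-complete
  where open Acceptable acceptable
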